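{- Let $G$ be a connected cubic graph and let $l \geq 1$ be an integer. Then $\chi_=(G \circ^l K_4) = 5$, where $K_4$ is the complete graph on $4$ vertices.
   Context: All graphs are finite and simple. A cubic graph is a $3$-regular graph. A graph $F$ is equitably $k$-colorable if $V(F)$ can be partitioned into $k$ (possibly empty) independent sets $V_1,\dots,V_k$ with $\bigl||V_i|-|V_j|\bigr|\le 1$ for all $i,j$. The equitable chromatic number $\chi_=(F)$ is the smallest integer $k$ such that $F$ is equitably $k$-colorable. The corona $G\circ H$ of graphs $G$ and $H$ is formed from one copy of $G$ and $|V(G)|$ disjoint copies of $H$ by joining the $i$-th vertex of $G$ to every vertex of the $i$-th copy of $H$. The $l$-corona product is defined by $G\circ^1 H = G\circ H$ and $G\circ^l H = (G\circ^{l-1}H)\circ H$ for $l\ge 2$. -}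

module Defs where

open import Data.Fin using (Fin) renaming (_≟_ to _≟ᶠ_)
open import Data.Fin.Properties using (+↔⊎; *↔×; inj⇒≟)
open import Data.List using (List; allFin; filter; length; map)
open import Data.Nat using (ℕ; zero; suc; _+_; _*_; _≤_; ∣_-_∣)
open import Data.Product using (_×_; _,_; Σ-syntax)
open import Data.Product.Function.NonDependent.Propositional using (_×-↔_)
open import Data.Sum using (_⊎_; inj₁; inj₂)
open import Data.Sum.Function.Propositional using (_⊎-↔_)
open import Function.Bundles using (_↔_; Inverse)
open import Function.Construct.Composition using (_↔-∘_)
open import Function.Construct.Identity using (↔-id)
open import Function.Construct.Symmetry using (↔-sym)
open import Function.Properties.Inverse using (↔⇒↣)
open import Relation.Binary.Construct.Closure.ReflexiveTransitive using (Star)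
open import Relation.Binary.Definitions
  using (Decidable; DecidableEquality; Irreflexive; Symmetric)
open import Relation.Binary.PropositionalEquality
  using (_≡_; _≢_; refl; sym; ≢-sym)
open import Relation.Nullary using (¬_)
open import Relation.Nullary.Decidable using (¬?; _×-dec_)

-- Finite simple graphs. Decidability of adjacency, automatic classically,
-- is part of the data so that neighbours can be counted.
record Graph : Set₁ where
  infix 4 _~_ _~?_
  field
    Vertex  : Set
    order   : ℕ
    enum    : Vertex ↔ Fin order
    _~_     : Vertex → Vertex → Set
    _~?_    : Decidable _~_
    ~-sym   : Symmetric _~_
    ~-irrefl : Irreflexive _≡_ _~_

  infix 4 _≟_
  _≟_ : DecidableEquality Vertex
  _≟_ = inj⇒≟ (↔⇒↣ enum)

  -- Every vertex occurs exactly once.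
  vertices : List Vertex
  vertices = map (Inverse.from enum) (allFin order)

  degree : Vertex → ℕ
  degree v = length (filter (v ~?_) vertices)

Cubic : Graph → Set
Cubic G = ∀ v → degree v ≡ 3
  where open Graph G

-- The graph without vertices does not count as connected.
Connected : Graph → Set
Connected G = Vertex × (∀ u v → Star _~_ u v)
  where open Graph G

K : ℕ → Graph
K n = record
  { Vertex   = Fin n
  ; order    = n
  ; enum     = ↔-id (Fin n)
  ; _~_      = _≢_
  ; _~?_     = λ i j → ¬? (i ≟ᶠ j)
  ; ~-sym    = ≢-sym
  ; ~-irrefl = λ i≡j i≢j → i≢j i≡j
  }

-- In the corona, inj₁ u is the vertex u of G, and inj₂ (u , x) is the vertex x
-- in the copy of H belonging to u.
module Corona (G H : Graph) where
  private
    module G = Graph G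
    module H = Graph H

  Vertex : Set
  Vertex = G.Vertex ⊎ (G.Vertex × H.Vertex)

  order : ℕ
  order = G.order + G.order * H.order

  enum : Vertex ↔ Fin order
  enum = ↔-sym +↔⊎ ↔-∘ (G.enum ⊎-↔ (↔-sym *↔× ↔-∘ (G.enum ×-↔ H.enum)))

  infix 4 _~_ _~?_
  _~_ : Vertex → Vertex → Set
  inj₁ u       ~ inj₁ v       = u G.~ v
  inj₁ u       ~ inj₂ (v , _) = u ≡ v
  inj₂ (u , _) ~ inj₁ v       = u ≡ v
  inj₂ (u , x) ~ inj₂ (v , y) = u ≡ v × x H.~ y

  _~?_ : Decidable _~_
  inj₁ u       ~? inj₁ v       = u G.~? v
  inj₁ u       ~? inj₂ (v , _) = u G.≟ v
  inj₂ (u , _) ~? inj₁ v       = u G.≟ v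
  inj₂ (u , x) ~? inj₂ (v , y) = (u G.≟ v) ×-dec (x H.~? y)

  ~-sym : Symmetric _~_
  ~-sym {inj₁ _} {inj₁ _} e       = G.~-sym e
  ~-sym {inj₁ _} {inj₂ _} e       = sym e
  ~-sym {inj₂ _} {inj₁ _} e       = sym e
  ~-sym {inj₂ _} {inj₂ _} (e , f) = sym e , H.~-sym f

  ~-irrefl : Irreflexive _≡_ _~_
  ~-irrefl {inj₁ _} refl e       = G.~-irrefl refl e
  ~-irrefl {inj₂ _} refl (_ , f) = H.~-irrefl refl f

infixl 7 _∘_ _∘^[_]_

_∘_ : Graph → Graph → Graph
G ∘ H = record
  { Vertex   = Vertex
  ; order    = order
  ; enum     = enum
  ; _~_      = _~_
  ; _~?_     = _~?_
  ; ~-sym    = λ {u} {v} → ~-sym {u} {v}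
  ; ~-irrefl = λ {u} {v} → ~-irrefl {u} {v}
  }
  where open Corona G H

-- The l-corona product, started at l = 0 with G itself, so that
-- G ∘^[ 1 ] H is G ∘ H by definition.
_∘^[_]_ : Graph → ℕ → Graph → Graph
G ∘^[ zero  ] H = G
G ∘^[ suc l ] H = (G ∘^[ l ] H) ∘ H

-- A partition into k possibly empty sets V₁, …, Vₖ is given by the map
-- sending each vertex to the index of the set containing it.
module _ (F : Graph) {k : ℕ} (colour : Graph.Vertex F → Fin k) where
  open Graph F

  classSize : Fin k → ℕ
  classSize i = length (filter (λ v → colour v ≟ᶠ i) vertices)

  IndependentClasses : Set
  IndependentClasses = ∀ i u v → colour u ≡ i → colour v ≡ i → ¬ (u ~ v)

  EquitableClasses : Set
  EquitableClasses = ∀ i j → ∣ classSize i - classSize j ∣ ≤ 1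

EquitablyColorable : Graph → ℕ → Set
EquitablyColorable F k =
  Σ[ colour ∈ (Graph.Vertex F → Fin k) ]
    IndependentClasses F colour × EquitableClasses F colour

-- χ₌ F ≔ k says that the equitable chromatic number of F equals k. It is a
-- relation, so that no search for the least k has to be part of the definition.
infix 4 χ₌_≔_
χ₌_≔_ : Graph → ℕ → Set
χ₌ F ≔ k = EquitablyColorable F k × (∀ m → EquitablyColorable F m → k ≤ m)

{-# OPTIONS --safe #-}

-- Let F be properly coloured with n + 1 colours, and colour the copy of K n
-- belonging to u with the n colours different from that of u. Then u and its
-- copy together carry every colour exactly once, so that all colour classes of
-- F ∘ K n have exactly |V(F)| elements. Greedy colouring starts the induction on
-- l, and u with its copy of K 4 is a clique that forces five colours.
module Submission where

open import Defs
open import Data.Fin using (Fin; zero; suc; punchIn; punchOut)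
open import Data.Fin.Properties
  using ( injective⇒≤; punchInᵢ≢i; punchIn-injective; punchIn-punchOut
        ; ¬∀⟶∃¬ )
  renaming (_≟_ to _≟ᶠ_)
open import Data.List using (List; []; _∷_; allFin; filter; length; map)
open import Data.List.Membership.DecPropositional using (_∈?_)
open import Data.List.Membership.Propositional using (_∈_; _∉_)
open import Data.List.Membership.Propositional.Properties
  using (∈-allFin; ∈-filter⁺; ∈-filter⁻; ∈-map⁺; ∈-map⁻)
open import Data.List.Membership.Propositional.Properties.WithK
  using (unique∧set⇒bag)
open import Data.List.Membership.Setoid.Properties using (index-injective)
open import Data.List.Properties using (length-map; length-tabulate)
open import Data.List.Relation.Binary.BagAndSetEquality using (∼bag⇒↭)
open import Data.List.Relation.Binary.Permutation.Propositional.Properties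
  using (↭-length)
open import Data.List.Relation.Unary.Any using (here; there; index)
open import Data.List.Relation.Unary.Unique.Propositional using (Unique)
open import Data.List.Relation.Unary.Unique.Propositional.Properties
  using (allFin⁺; filter⁺; map⁺)
open import Data.Nat using (ℕ; zero; suc; _≤_; _<_; z≤n; s≤s)
open import Data.Nat.Properties using (≤-trans; <⇒≱; m≡n⇒∣m-n∣≡0)
open import Data.Product using (_×_; _,_; proj₁; proj₂; Σ-syntax; ∃-syntax)
open import Data.Sum using (inj₁; inj₂)
open import Function using (_∘′_)
open import Function.Bundles using (Injection; Inverse; mk⇔)
open import Function.Construct.Symmetry using (↔-sym)
open import Function.Properties.Inverse using (↔⇒↣)
open import Relation.Binary.PropositionalEquality
  using (_≡_; _≢_; refl; sym; trans; cong; subst; setoid; module ≡-Reasoning)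
open import Relation.Nullary using (yes; no; contradiction)
open import Relation.Nullary.Decidable using (decidable-stable)

-- Without repetitions, equality as sets is equality as bags, so the lists are permutations of each
-- other. A colour class is counted this way.
unique∧set⇒length≡ : {A : Set} {xs ys : List A} → Unique xs → Unique ys →
  (∀ {x} → x ∈ xs → x ∈ ys) → (∀ {x} → x ∈ ys → x ∈ xs) →
  length xs ≡ length ys
unique∧set⇒length≡ xs! ys! xs⊆ys ys⊆xs =
  ↭-length (∼bag⇒↭ (unique∧set⇒bag xs! ys! (mk⇔ xs⊆ys ys⊆xs)))

-- Pigeonhole: if every colour occurred, sending it to its position would inject `Fin k` into the
-- positions of `xs`.
length<⇒∃∉ : ∀ {k} (xs : List (Fin k)) → length xs < k → ∃[ i ] i ∉ xs
length<⇒∃∉ {k} xs xs<k =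
  ¬∀⟶∃¬ k (_∈ xs) (λ i → _∈?_ _≟ᶠ_ i xs) λ all∈ →
    <⇒≱ xs<k (injective⇒≤ {f = λ i → index (all∈ i)}
      λ {i} {j} → index-injective (setoid _) (all∈ i) (all∈ j))

Proper : (F : Graph) {k : ℕ} → (Graph.Vertex F → Fin k) → Set
Proper F c = ∀ {u v} → u ~ v → c u ≢ c v
  where open Graph F

ProperlyColorable : Graph → ℕ → Set
ProperlyColorable F k = Σ[ c ∈ (Graph.Vertex F → Fin k) ] Proper F c

proper⇒independentClasses : (F : Graph) {k : ℕ} {c : Graph.Vertex F → Fin k} →
  Proper F c → IndependentClasses F c
proper⇒independentClasses F proper i u v cu≡i cv≡i u~v =
  proper u~v (trans cu≡i (sym cv≡i))

module _ (F : Graph) where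
  open Graph F

  vertices-unique : Unique vertices
  vertices-unique =
    map⁺ (Injection.injective (↔⇒↣ (↔-sym enum))) (allFin⁺ order)

  ∈-vertices : ∀ v → v ∈ vertices
  ∈-vertices v =
    subst (_∈ vertices) (Inverse.strictlyInverseʳ enum v)
      (∈-map⁺ (Inverse.from enum) (∈-allFin (Inverse.to enum v)))

  length-vertices : length vertices ≡ order
  length-vertices =
    trans (length-map (Inverse.from enum) (allFin order)) (length-tabulate {n = order} _)

  -- Induction on `xs`, the head being coloured last. The colouring is total, but properness is
  -- claimed only inside `xs`; elsewhere the colours are placeholders.
  greedy : ∀ {k} → (∀ v → degree v < k) → (xs : List Vertex) →
    Σ[ c ∈ (Vertex → Fin k) ]
      (∀ {u v} → u ∈ xs → v ∈ xs → u ~ v → c u ≢ c v)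
  -- A default colour exists because the degree bound at `v` itself gives `1 ≤ k`.
  greedy deg<k [] = (λ v → proj₁ (length<⇒∃∉ [] (≤-trans (s≤s z≤n) (deg<k v)))) , λ ()
  greedy {k} deg<k (x ∷ xs) = c′ , proper′
    where
    c : Vertex → Fin k
    c = proj₁ (greedy deg<k xs)

    proper : ∀ {u v} → u ∈ xs → v ∈ xs → u ~ v → c u ≢ c v
    proper = proj₂ (greedy deg<k xs)

    -- These include neighbours outside `xs`. Avoiding their placeholder colours too is affordable,
    -- since `k` exceeds the full degree.
    neighbours : List Vertex
    neighbours = filter (x ~?_) vertices

    free : ∃[ i ] i ∉ map c neighbours
    free = length<⇒∃∉ (map c neighbours)
      (subst (_< k) (sym (length-map c neighbours)) (deg<k x))

    c′ : Vertex → Fin k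
    c′ v with v ≟ x
    ... | yes _ = proj₁ free
    ... | no  _ = c v

    free-≢ : ∀ {v} → x ~ v → proj₁ free ≢ c v
    free-≢ {v} x~v free≡cv = proj₂ free
      (subst (_∈ map c neighbours) (sym free≡cv)
        (∈-map⁺ c (∈-filter⁺ (x ~?_) (∈-vertices v) x~v)))

    ∈-tail : ∀ {v} → v ≢ x → v ∈ x ∷ xs → v ∈ xs
    ∈-tail v≢x (here v≡x)   = contradiction v≡x v≢x
    ∈-tail v≢x (there v∈xs) = v∈xs

    proper′ : ∀ {u v} → u ∈ x ∷ xs → v ∈ x ∷ xs → u ~ v → c′ u ≢ c′ v
    proper′ {u} {v} u∈ v∈ u~v with u ≟ x | v ≟ x
    ... | yes refl | yes refl = contradiction u~v (~-irrefl refl)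
    ... | yes refl | no  _    = free-≢ u~v
    ... | no  _    | yes refl = free-≢ (~-sym u~v) ∘′ sym
    ... | no  u≢x  | no  v≢x  = proper (∈-tail u≢x u∈) (∈-tail v≢x v∈) u~v

  degree<⇒properlyColorable : ∀ {k} → (∀ v → degree v < k) → ProperlyColorable F k
  degree<⇒properlyColorable deg<k =
    let c , proper = greedy deg<k vertices
    in c , λ {u} {v} → proper (∈-vertices u) (∈-vertices v)

module _ (F : Graph) {n : ℕ} where
  open Graph F using (Vertex)
  private
    module C = Graph (F ∘ K n)

  coronaColour : (Vertex → Fin (suc n)) → C.Vertex → Fin (suc n)
  coronaColour c (inj₁ u)       = c u
  coronaColour c (inj₂ (u , x)) = punchIn (c u) x

  -- Edges between `u` and its copy are fine because `punchIn (c u)` misses `c u`, edges within the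
  -- copy because it is injective.
  coronaColour-proper : ∀ {c} → Proper F c → Proper (F ∘ K n) (coronaColour c)
  coronaColour-proper     proper {inj₁ u}       {inj₁ v}        u~v        = proper u~v
  coronaColour-proper {c} proper {inj₁ u}       {inj₂ (.u , x)} refl       =
    punchInᵢ≢i (c u) x ∘′ sym
  coronaColour-proper {c} proper {inj₂ (u , x)} {inj₁ .u}       refl       =
    punchInᵢ≢i (c u) x
  coronaColour-proper {c} proper {inj₂ (u , x)} {inj₂ (.u , y)} (refl , x≢y) =
    x≢y ∘′ punchIn-injective (c u) x y

  module _ (c : Vertex → Fin (suc n)) (i : Fin (suc n)) where

    -- The one vertex of colour `i` among `u` and its copy. As `u` varies, this is a bijection onto
    -- class `i` with inverse `base`.
    representative : Vertex → C.Vertex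
    representative u with c u ≟ᶠ i
    ... | yes _    = inj₁ u
    ... | no  cu≢i = inj₂ (u , punchOut cu≢i)

    base : C.Vertex → Vertex
    base (inj₁ u)       = u
    base (inj₂ (u , _)) = u

    base-representative : ∀ u → base (representative u) ≡ u
    base-representative u with c u ≟ᶠ i
    ... | yes _ = refl
    ... | no  _ = refl

    representative-injective : ∀ {u v} → representative u ≡ representative v → u ≡ v
    representative-injective {u} {v} eq =
      trans (sym (base-representative u)) (trans (cong base eq) (base-representative v))

    coronaColour-representative : ∀ u → coronaColour c (representative u) ≡ i
    coronaColour-representative u with c u ≟ᶠ i
    ... | yes cu≡i = cu≡i
    ... | no  cu≢i = punchIn-punchOut cu≢i

    -- Uniqueness of the representative: if `u` has colour `i`, no vertex of its copy does;
    -- otherwise injectivity of `punchIn (c u)` fixes the vertex of the copy.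
    representative-base : ∀ w → coronaColour c w ≡ i → w ≡ representative (base w)
    representative-base (inj₁ u) cu≡i with c u ≟ᶠ i
    ... | yes _    = refl
    ... | no  cu≢i = contradiction cu≡i cu≢i
    representative-base (inj₂ (u , x)) eq with c u ≟ᶠ i
    ... | yes cu≡i = contradiction (trans eq (sym cu≡i)) (punchInᵢ≢i (c u) x)
    ... | no  cu≢i = cong (λ y → inj₂ (u , y))
      (punchIn-injective (c u) x _ (trans eq (sym (punchIn-punchOut cu≢i))))

    coronaColour-classSize : classSize (F ∘ K n) (coronaColour c) i ≡ Graph.order F
    coronaColour-classSize = begin
      length class                                   ≡⟨ unique∧set⇒length≡ class! reps! class⊆reps reps⊆class ⟩
      length (map representative (Graph.vertices F)) ≡⟨ length-map representative (Graph.vertices F) ⟩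
      length (Graph.vertices F)                      ≡⟨ length-vertices F ⟩
      Graph.order F                                  ∎
      where
      open ≡-Reasoning

      class : List C.Vertex
      class = filter (λ w → coronaColour c w ≟ᶠ i) C.vertices

      class! : Unique class
      class! = filter⁺ (λ w → coronaColour c w ≟ᶠ i) (vertices-unique (F ∘ K n))

      reps! : Unique (map representative (Graph.vertices F))
      reps! = map⁺ representative-injective (vertices-unique F)

      class⊆reps : ∀ {w} → w ∈ class → w ∈ map representative (Graph.vertices F)
      class⊆reps {w} w∈ =
        subst (_∈ map representative (Graph.vertices F))
          (sym (representative-base w
            (proj₂ (∈-filter⁻ (λ w → coronaColour c w ≟ᶠ i) {xs = C.vertices} w∈))))
          (∈-map⁺ representative (∈-vertices F (base w)))

      reps⊆class : ∀ {w} → w ∈ map representative (Graph.vertices F) → w ∈ class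
      reps⊆class w∈ with ∈-map⁻ representative w∈
      ... | u , _ , refl = ∈-filter⁺ (λ w → coronaColour c w ≟ᶠ i)
        (∈-vertices (F ∘ K n) (representative u)) (coronaColour-representative u)

  corona-properlyColorable : ProperlyColorable F (suc n) → ProperlyColorable (F ∘ K n) (suc n)
  corona-properlyColorable (c , proper) =
    coronaColour c , λ {u} {v} → coronaColour-proper proper {u} {v}

  corona-equitablyColorable : ProperlyColorable F (suc n) → EquitablyColorable (F ∘ K n) (suc n)
  corona-equitablyColorable (c , proper) =
    coronaColour c ,
    proper⇒independentClasses (F ∘ K n) (λ {u} {v} → coronaColour-proper proper {u} {v}) ,
    -- Both classes have exactly `Graph.order F` elements, so the difference is 0.
    λ i j → subst (_≤ 1)
      (sym (m≡n⇒∣m-n∣≡0 (trans (coronaColour-classSize c i) (sym (coronaColour-classSize c j)))))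
      z≤n

  corona-colours≥ : Vertex → ∀ {m} → EquitablyColorable (F ∘ K n) m → suc n ≤ m
  corona-colours≥ r (c , independent , _) = injective⇒≤ {f = λ i → c (clique i)} λ {i} {j} eq →
    -- Independence only refutes `i ≢ j`; decidable equality on `Fin` turns this into `i ≡ j`, so
    -- the colouring is injective on the clique.
    decidable-stable (i ≟ᶠ j) λ i≢j →
      independent _ (clique i) (clique j) eq refl (clique-~ i j i≢j)
    where
    clique : Fin (suc n) → C.Vertex
    clique zero    = inj₁ r
    clique (suc x) = inj₂ (r , x)

    clique-~ : ∀ i j → i ≢ j → clique i C.~ clique j
    clique-~ zero    zero    i≢j = contradiction refl i≢j
    clique-~ zero    (suc _) _   = refl
    clique-~ (suc _) zero    _   = refl
    clique-~ (suc _) (suc _) i≢j = refl , i≢j ∘′ cong suc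

  corona-χ₌ : Vertex → ProperlyColorable F (suc n) → χ₌ (F ∘ K n) ≔ suc n
  corona-χ₌ r colorable = corona-equitablyColorable colorable , λ _ → corona-colours≥ r

module _ (G : Graph) {n : ℕ} where

  -- Only properness is carried through the induction; one further corona then makes the classes
  -- equal in size.
  iteratedCorona-properlyColorable : ∀ l → ProperlyColorable G (suc n) →
    ProperlyColorable (G ∘^[ l ] K n) (suc n)
  iteratedCorona-properlyColorable zero    colorable = colorable
  iteratedCorona-properlyColorable (suc l) colorable =
    corona-properlyColorable (G ∘^[ l ] K n) (iteratedCorona-properlyColorable l colorable)

  -- Provides the vertex at which the clique of the lower bound is rooted.
  iteratedCorona-vertex : ∀ l → Graph.Vertex G → Graph.Vertex (G ∘^[ l ] K n)
  iteratedCorona-vertex zero    v = v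
  iteratedCorona-vertex (suc l) v = inj₁ (iteratedCorona-vertex l v)

theorem3p8 : (G : Graph) → Connected G → Cubic G →
    (l : ℕ) → 1 ≤ l → χ₌ (G ∘^[ l ] K 4) ≔ 5
theorem3p8 G (r , _) cubic (suc l) _ =
  -- The first `l` coronas keep five colours proper; the last one gives equitability and the lower
  -- bound.
  corona-χ₌ (G ∘^[ l ] K 4) (iteratedCorona-vertex G l r)
    (iteratedCorona-properlyColorable G l (degree<⇒properlyColorable G degree<5))
  where
  degree<5 : ∀ v → Graph.degree G v < 5
  -- The bound is 5 because coronas with `K 4` extend colourings in `suc 4` colours.
  degree<5 v = subst (_< 5) (sym (cubic v)) (s≤s (s≤s (s≤s (s≤s z≤n))))
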